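{- For every integer $n\ge1$, the optimal worst-case success probability of deterministic policies in the adversarial-order full-history model with $m=2$ signals (defined in the context) is $$\mathrm{OPT}^{\mathrm{det,full}}_n(2)=\max\Bigl\{z\in[0,1]:\ \sum_{t=1}^{\ell}\lceil z t^2\rceil\le\ell^2\ \text{ for all }\ell\in[n]\Bigr\}.$$
   Context: Notation: $[n]=\{1,\dots,n\}$. Adversarial-order full-history model with $m$ signals: an adversary fixes an instance, i.e. a value vector $v\in\mathbb{N}_0^n$ with a unique maximum entry, located at a time $i^\star\in[n]$. Items arrive one by one at times $1,\dots,n$ in this order. Signal times $S_1,\dots,S_m$ are drawn independently and uniformly from $[i^\star]$. At each time $t$ the policy observes $v_t$ and the number of signals occurring at time $t$ (signals are unlabeled), and then irrevocably decides whether to stop at time $t$. It knows $n$ and $m$, but not the instance; it succeeds if it stops exactly at time $i^\star$. A deterministic policy uses no internal randomness: its decision at time $t$ is a function of the observations up to time $t$. The worst-case success probability of a policy is the infimum over all instances of length $n$ of its success probability (over the signals). $\mathrm{OPT}^{\mathrm{det,full}}_n(m)$ is the supremum of the worst-case success probability over all deterministic policies. -}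

module Defs where

open import Data.Bool using (Bool; true; false)
import Data.Bool.Properties as Bool
open import Data.Fin using (Fin; toℕ; inject≤) renaming (_<_ to _<ᶠ_; _<?_ to _<ᶠ?_)
open import Data.Fin.Properties using (all?; toℕ<n)
open import Data.Integer as ℤ using (ℤ; +_)
open import Data.List as List using (List; []; _∷_; cartesianProductWith; allFin; filter; length)
open import Data.Nat as ℕ using (ℕ; zero; suc; _^_; NonZero)
import Data.Nat.Properties as ℕ
open import Data.Product using (∃; _×_; _,_)
open import Data.Rational as ℚ using (ℚ; _/_; 1/_; 1ℚ; Positive)
import Data.Rational.Properties as ℚ
open import Data.Sum using (_⊎_; inj₁; inj₂)
open import Data.Vec as Vec using (Vec; tabulate; count)
open import Function using (_⇔_; mk⇔; Equivalence)
open import Level using (0ℓ) renaming (suc to lsuc)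
open import Relation.Binary.Definitions using (tri<; tri≈; tri>)
open import Relation.Binary.PropositionalEquality
  using (_≡_; _≢_; refl; sym; trans; cong; subst)
open import Relation.Nullary using (¬_)
open import Relation.Nullary.Decidable using (_×-dec_; _→-dec_)
open import Relation.Unary using (Pred; Decidable)

record ℝ : Set₁ where
  field
    L U         : Pred ℚ 0ℓ
    L-inhabited : ∃ L
    U-inhabited : ∃ U
    L-rounded   : ∀ p → L p ⇔ (∃ λ q → p ℚ.< q × L q)
    U-rounded   : ∀ q → U q ⇔ (∃ λ p → p ℚ.< q × U p)
    disjoint    : ∀ q → ¬ (L q × U q)
    located     : ∀ {p q} → p ℚ.< q → L p ⊎ U q

open ℝ

infix 4 _≤ℝ_ _<ℝ_

_≤ℝ_ : ℝ → ℝ → Set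
x ≤ℝ y = ∀ q → L x q → L y q

_<ℝ_ : ℝ → ℝ → Set
x <ℝ y = ∃ λ q → U x q × L y q

fromℚ : ℚ → ℝ
fromℚ r = record
  { L           = ℚ._< r
  ; U           = r ℚ.<_
  ; L-inhabited = r ℚ.- 1ℚ ,
                  subst (r ℚ.- 1ℚ ℚ.<_) (ℚ.+-identityʳ r)
                    (ℚ.+-monoʳ-< r (ℚ.negative⁻¹ (ℚ.- 1ℚ)))
  ; U-inhabited = r ℚ.+ 1ℚ ,
                  subst (ℚ._< r ℚ.+ 1ℚ) (ℚ.+-identityʳ r)
                    (ℚ.+-monoʳ-< r (ℚ.positive⁻¹ 1ℚ))
  ; L-rounded   = λ p → mk⇔ ℚ.<-dense (λ (q , p<q , q<r) → ℚ.<-trans p<q q<r)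
  ; U-rounded   = λ q → mk⇔
                  (λ r<q → let p , r<p , p<q = ℚ.<-dense r<q in p , p<q , r<p)
                  (λ (p , p<q , r<p) → ℚ.<-trans r<p p<q)
  ; disjoint    = λ q (q<r , r<q) → ℚ.<-asym q<r r<q
  ; located     = loc
  }
  where
  loc : ∀ {p q} → p ℚ.< q → p ℚ.< r ⊎ r ℚ.< q
  loc {p} {q} p<q with ℚ.<-cmp p r
  ... | tri< p<r _ _ = inj₁ p<r
  ... | tri≈ _ p≡r _ = inj₂ (subst (ℚ._< q) p≡r p<q)
  ... | tri> _ _ r<p = inj₂ (ℚ.<-trans r<p p<q)

fromℤ : ℤ → ℝ
fromℤ i = fromℚ (i / 1)

-- The product of a real and a positive integer: q < x · k iff q / k < x.

infixl 7 _·_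

_·_ : ℝ → (k : ℕ) → .{{NonZero k}} → ℝ
x · k = record
  { L           = λ q → L x (q ℚ.* d)
  ; U           = λ q → U x (q ℚ.* d)
  ; L-inhabited = let q , Lq = L-inhabited x in q ℚ.* e , subst (L x) (sym (cancel q)) Lq
  ; U-inhabited = let q , Uq = U-inhabited x in q ℚ.* e , subst (U x) (sym (cancel q)) Uq
  ; L-rounded   = λ p → mk⇔
      (λ Lp → let q , pd<q , Lq = Equivalence.to (L-rounded x (p ℚ.* d)) Lp in
        q ℚ.* e ,
        cancel-< (subst (p ℚ.* d ℚ.<_) (sym (cancel q)) pd<q) ,
        subst (L x) (sym (cancel q)) Lq)
      (λ (q , p<q , Lq) →
        Equivalence.from (L-rounded x (p ℚ.* d)) (q ℚ.* d , mono-< p<q , Lq))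
  ; U-rounded   = λ q → mk⇔
      (λ Uq → let p , p<qd , Up = Equivalence.to (U-rounded x (q ℚ.* d)) Uq in
        p ℚ.* e ,
        cancel-< (subst (ℚ._< q ℚ.* d) (sym (cancel p)) p<qd) ,
        subst (U x) (sym (cancel p)) Up)
      (λ (p , p<q , Up) →
        Equivalence.from (U-rounded x (q ℚ.* d)) (p ℚ.* d , mono-< p<q , Up))
  ; disjoint    = λ q → disjoint x (q ℚ.* d)
  ; located     = λ p<q → located x (mono-< p<q)
  }
  where
  d : ℚ
  d = + 1 / k

  instance
    d-pos : Positive d
    d-pos = ℚ.normalize-pos 1 k

    d≢0 : ℚ.NonZero d
    d≢0 = ℚ.pos⇒nonZero d

  e : ℚ
  e = 1/ d

  cancel : ∀ q → q ℚ.* e ℚ.* d ≡ q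
  cancel q = trans (ℚ.*-assoc q e d)
               (trans (cong (q ℚ.*_) (ℚ.*-inverseˡ d)) (ℚ.*-identityʳ q))

  mono-< : ∀ {p q} → p ℚ.< q → p ℚ.* d ℚ.< q ℚ.* d
  mono-< = ℚ.*-monoˡ-<-pos d

  cancel-< : ∀ {p q} → p ℚ.* d ℚ.< q ℚ.* d → p ℚ.< q
  cancel-< = ℚ.*-cancelʳ-<-pos d d-pos

-- The ceiling is a relation because it is not computable from a cut.

IsCeiling : ℝ → ℤ → Set
IsCeiling x k = fromℤ (k ℤ.- + 1) <ℝ x × x ≤ℝ fromℤ k

IsSup IsInf IsMax : Pred ℝ (lsuc 0ℓ) → Pred ℝ (lsuc 0ℓ)
IsSup P s = (∀ x → P x → x ≤ℝ s) × (∀ b → (∀ x → P x → x ≤ℝ b) → s ≤ℝ b)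
IsInf P s = (∀ x → P x → s ≤ℝ x) × (∀ b → (∀ x → P x → b ≤ℝ x) → b ≤ℝ s)
IsMax P s = P s × (∀ x → P x → x ≤ℝ s)

-- Time t ∈ [n] is the element of Fin n with toℕ equal to t - 1.

record Instance (n : ℕ) : Set where
  field
    value     : Fin n → ℕ
    i⋆        : Fin n
    uniqueMax : ∀ j → j ≢ i⋆ → value j ℕ.< value i⋆

  -- The size of [i⋆].
  horizon : ℕ
  horizon = suc (toℕ i⋆)

-- A pair of the current value and the current number of signals.

Observation : Set
Observation = ℕ × ℕ

-- The history at a time t has one entry for each time up to and including t;
-- true means stop.

Policy : ℕ → Set
Policy n = (t : Fin n) → Vec Observation (suc (toℕ t)) → Bool

module _ {n : ℕ} (I : Instance n) where
  open Instance I

  Signals : ℕ → Set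
  Signals m = Vec (Fin horizon) m

  signalsAt : ∀ {m} → Signals m → ℕ → ℕ
  signalsAt S t = count (λ s → toℕ s ℕ.≟ t) S

  history : ∀ {m} → Signals m → (t : Fin n) → Vec Observation (suc (toℕ t))
  history S t = tabulate λ s → value (inject≤ s (toℕ<n t)) , signalsAt S (toℕ s)

  -- A policy acts by its first decision to stop.

  StopsAt : ∀ {m} → Policy n → Signals m → Fin n → Set
  StopsAt π S t =
    π t (history S t) ≡ true × (∀ s → s <ᶠ t → π s (history S s) ≡ false)

  Succeeds : ∀ {m} → Policy n → Pred (Signals m) 0ℓ
  Succeeds π S = StopsAt π S i⋆

  succeeds? : ∀ {m} (π : Policy n) → Decidable (Succeeds {m} π)
  succeeds? π S =
    (π i⋆ (history S i⋆) Bool.≟ true) ×-dec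
    all? (λ s → (s <ᶠ? i⋆) →-dec (π s (history S s) Bool.≟ false))

-- Every vector in (Fin k)ᵐ, exactly once.

allVecs : (k m : ℕ) → List (Vec (Fin k) m)
allVecs k zero    = Vec.[] ∷ []
allVecs k (suc m) = cartesianProductWith Vec._∷_ (allFin k) (allVecs k m)

-- Independent uniform signals are uniform on the horizonᵐ signal vectors.

successProbability : ∀ {n} (m : ℕ) → Policy n → Instance n → ℚ
successProbability m π I =
  (+ length (filter (succeeds? I π) (allVecs horizon m)) / (horizon ^ m))
    {{ℕ.m^n≢0 horizon m}}
  where open Instance I

IsWorstCase : ∀ {n} (m : ℕ) → Policy n → ℝ → Set₁
IsWorstCase {n} m π =
  IsInf λ x → ∃ λ (I : Instance n) → x ≡ fromℚ (successProbability m π I)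

IsOPT : (n m : ℕ) → ℝ → Set₁
IsOPT n m = IsSup λ x → ∃ λ (π : Policy n) → IsWorstCase m π x

Σ₁ : ℕ → (ℕ → ℤ) → ℤ
Σ₁ zero    c = + 0
Σ₁ (suc ℓ) c = Σ₁ ℓ c ℤ.+ c (suc ℓ)

record Feasible (n : ℕ) (z : ℝ) : Set₁ where
  field
    nonNegative : fromℤ (+ 0) ≤ℝ z
    atMostOne   : z ≤ℝ fromℤ (+ 1)
    ⌈z·_²⌉      : ℕ → ℤ
    isCeiling   : ∀ t .{{_ : NonZero t}} → t ℕ.≤ n →
                  IsCeiling ((z · (t ^ 2)) {{ℕ.m^n≢0 t 2}}) (⌈z·_²⌉ t)
    sum≤        : ∀ ℓ .{{_ : NonZero ℓ}} → ℓ ℕ.≤ n →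
                  Σ₁ ℓ ⌈z·_²⌉ ℤ.≤ + (ℓ ^ 2)

{-# OPTIONS --safe #-}

-- On increasing values, all instances share their histories up to the maximum,
-- so the sets A_t ⊆ [t]² of signal pairs on which a deterministic policy stops
-- exactly at t are disjoint, whence Σ_{t≤ℓ} |A_t| ≤ ℓ². Conversely, disjoint
-- sets A_t ⊆ [t]² that are closed under swapping the two signals define a policy
-- which ignores the values and reads the signal pair off the counts. Such sets of
-- sizes c_t = ⌈z t²⌉ are chosen greedily, taking unordered pairs a ≠ b (of weight 2)
-- before doubles (a , a): the new double (t , t) settles the parity of c_t.
-- The optimum is rational: all fractions N / t² with t ≤ n are multiples of 1 / (n!)².

module Submission where

open import Defs
open import Data.Bool using (true; false)
open import Data.Fin as Fin using (Fin; toℕ; fromℕ<; inject≤)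
  renaming (_<_ to _<ᶠ_; _≤_ to _≤ᶠ_; _≤?_ to _≤ᶠ?_)
import Data.Fin.Properties as Fin
open import Data.Integer as ℤ using (ℤ; +_; -[1+_])
import Data.Integer.Properties as ℤ
open import Data.List as List using (List; []; _∷_; _++_; length; filter; map; applyUpTo)
import Data.List.Properties as List
open import Data.List.Membership.Propositional using (_∈_)
open import Data.List.Membership.Propositional.Properties
  using (∈-∃++; ∈-++⁻; ∈-++⁺ˡ; ∈-++⁺ʳ; ∈-map⁺; ∈-map⁻; ∈-filter⁺; ∈-filter⁻; ∈-allFin;
         ∈-applyUpTo⁻; ∈-cartesianProductWith⁺)
open import Data.List.Relation.Binary.Subset.Propositional using (_⊆_)
open import Data.List.Relation.Unary.All as All using ()
open import Data.List.Relation.Unary.AllPairs using ([]; _∷_)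
open import Data.List.Relation.Unary.Any using (here; there)
open import Data.List.Relation.Unary.Unique.Propositional using (Unique)
import Data.List.Relation.Unary.Unique.Propositional.Properties as Unique
open import Data.Nat as ℕ using (ℕ; zero; suc; _^_; _!; _⊔_; _⊓_; _≥_; NonZero; z≤n; s≤s)
open import Data.Nat.Divisibility
  using (_∣_; divides; *-pres-∣; ∣-refl; ∣-trans; m∣m*n; m≤n⇒m!∣n!)
import Data.Nat.DivMod as ℕ
import Data.Nat.Properties as ℕ
open import Data.Nat.Solver using (module +-*-Solver)
open import Data.Product using (∃; _×_; _,_; proj₁; proj₂)
open import Data.Rational as ℚ using (ℚ; mkℚ; _/_; ↥_; ↧_; toℚᵘ; Positive)
import Data.Rational.Properties as ℚ
import Data.Rational.Unnormalised as ℚᵘ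
import Data.Rational.Unnormalised.Properties as ℚᵘ
open import Data.Sum using (_⊎_; inj₁; inj₂)
open import Data.Vec as Vec using (Vec; []; _∷_; tabulate; count; lookup)
import Data.Vec.Properties as Vec
open import Data.Vec.Relation.Unary.All as VecAll using ([]; _∷_)
open import Function using (_∘_; Equivalence)
open import Level using (0ℓ)
open import Relation.Binary.Definitions using (tri<; tri≈; tri>)
open import Relation.Binary.PropositionalEquality
open import Relation.Nullary using (¬_; Dec; does; yes; no; contradiction)
open import Relation.Nullary.Decidable using (dec-true; dec-false; ¬?; _×-dec_; _⊎-dec_)
open import Relation.Unary using (Pred; Decidable)

-- Comparing fractions by cross-multiplication, and passing between cuts of x and `x · m`.

toℚᵘ-/ : ∀ i m .{{_ : NonZero m}} → toℚᵘ (i / m) ℚᵘ.≃ (i ℚᵘ./ m)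
toℚᵘ-/ i (suc m) = ℚ.toℚᵘ-fromℚᵘ (ℚᵘ.mkℚᵘ i m)

</-cross : ∀ q i m .{{_ : NonZero m}} → q ℚ.< i / m → ↥ q ℤ.* + m ℤ.< i ℤ.* ↧ q
</-cross q@record{} i m@(suc _) q< with ℚᵘ.<-respʳ-≃ (toℚᵘ-/ i m) (ℚ.toℚᵘ-mono-< q<)
... | ℚᵘ.*<* p = p

cross-</ : ∀ q i m .{{_ : NonZero m}} → ↥ q ℤ.* + m ℤ.< i ℤ.* ↧ q → q ℚ.< i / m
cross-</ q@record{} i m@(suc _) p =
  ℚ.toℚᵘ-cancel-< (ℚᵘ.<-respʳ-≃ (ℚᵘ.≃-sym (toℚᵘ-/ i m)) (ℚᵘ.*<* p))

/-mono-< : ∀ i m j n .{{_ : NonZero m}} .{{_ : NonZero n}} →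
           i ℤ.* + n ℤ.< j ℤ.* + m → i / m ℚ.< j / n
/-mono-< i m@(suc _) j n@(suc _) p = ℚ.toℚᵘ-cancel-<
  (ℚᵘ.<-respˡ-≃ (ℚᵘ.≃-sym (toℚᵘ-/ i m)) (ℚᵘ.<-respʳ-≃ (ℚᵘ.≃-sym (toℚᵘ-/ j n)) (ℚᵘ.*<* p)))

/-mono-≤ : ∀ i m j n .{{_ : NonZero m}} .{{_ : NonZero n}} →
           i ℤ.* + n ℤ.≤ j ℤ.* + m → i / m ℚ.≤ j / n
/-mono-≤ i m@(suc _) j n@(suc _) p = ℚ.toℚᵘ-cancel-≤
  (ℚᵘ.≤-respˡ-≃ (ℚᵘ.≃-sym (toℚᵘ-/ i m)) (ℚᵘ.≤-respʳ-≃ (ℚᵘ.≃-sym (toℚᵘ-/ j n)) (ℚᵘ.*≤* p)))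

/1*1/ : ∀ i m .{{_ : NonZero m}} → i / 1 ℚ.* (+ 1 / m) ≡ i / m
/1*1/ i m@(suc m-1) = ℚ.toℚᵘ-injective (begin
  toℚᵘ (i / 1 ℚ.* (+ 1 / m))                ≈⟨ ℚ.toℚᵘ-homo-* (i / 1) (+ 1 / m) ⟩
  toℚᵘ (i / 1) ℚᵘ.* toℚᵘ (+ 1 / m)          ≈⟨ ℚᵘ.*-cong (toℚᵘ-/ i 1) (toℚᵘ-/ (+ 1) m) ⟩
  ℚᵘ.mkℚᵘ i 0 ℚᵘ.* ℚᵘ.mkℚᵘ (+ 1) m-1        ≈⟨ ℚᵘ.*≡* numerators ⟩
  ℚᵘ.mkℚᵘ i m-1                             ≈⟨ toℚᵘ-/ i m ⟨
  toℚᵘ (i / m)                              ∎)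
  where
  open ℚᵘ.≃-Reasoning
  numerators : i ℤ.* + 1 ℤ.* + m ≡ i ℤ.* + (1 ℕ.* m)
  numerators = cong₂ ℤ._*_ (ℤ.*-identityʳ i) (cong +_ (sym (ℕ.*-identityˡ m)))

fromℚ-mono : ∀ {p q} → p ℚ.≤ q → fromℚ p ≤ℝ fromℚ q
fromℚ-mono p≤q _ = λ r<p → ℚ.<-≤-trans r<p p≤q

-- The lower cut of `x · m` at `q * e` is by definition that of `x` at `q * e * d`, which is q. So a
-- rational q below x is scaled up by m, compared with i, and scaled down again.
·-≤-fromℤ : ∀ x i m .{{_ : NonZero m}} → (x · m) ≤ℝ fromℤ i → x ≤ℝ fromℚ (i / m)
·-≤-fromℤ x i m xm≤i q Lq = subst₂ ℚ._<_ cancel (/1*1/ i m) (ℚ.*-monoˡ-<-pos d q*e<i)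
  where
  d e : ℚ
  d = + 1 / m
  instance
    d-pos : Positive d
    d-pos = ℚ.normalize-pos 1 m
    d≢0 : ℚ.NonZero d
    d≢0 = ℚ.pos⇒nonZero d
  e = ℚ.1/ d
  cancel : q ℚ.* e ℚ.* d ≡ q
  cancel = trans (ℚ.*-assoc q e d)
             (trans (cong (q ℚ.*_) (ℚ.*-inverseˡ d)) (ℚ.*-identityʳ q))
  q*e<i : q ℚ.* e ℚ.< i / 1
  q*e<i = xm≤i (q ℚ.* e) (subst (ℝ.L x) (sym cancel) Lq)

fromℚ-isCeiling : ∀ r i m .{{_ : NonZero m}} →
  (i ℤ.- + 1) / m ℚ.< r → r ℚ.≤ i / m → IsCeiling (fromℚ r · m) i
fromℚ-isCeiling r i m lower upper =
  -- `_<ℝ_` asks for a rational strictly in between; roundedness of the lower cut extracts one from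
  -- (i - 1) / m < r.
  Equivalence.to (ℝ.L-rounded (fromℚ r · m) ((i ℤ.- + 1) / 1))
    (subst (ℚ._< r) (sym (/1*1/ (i ℤ.- + 1) m)) lower) ,
  λ q qd<r → ℚ.*-cancelʳ-<-nonNeg d {{ℚ.normalize-nonNeg 1 m}}
    (subst (q ℚ.* d ℚ.<_) (sym (/1*1/ i m)) (ℚ.<-≤-trans qd<r upper))
  where
  d : ℚ
  d = + 1 / m

-- Ceiling division, bounded search and finite sums.

⌈_/_⌉ : ℕ → (d : ℕ) .{{_ : NonZero d}} → ℕ
⌈ a / d ⌉ = (a ℕ.+ ℕ.pred d) ℕ./ d

≤⌈/⌉* : ∀ a d .{{_ : NonZero d}} → a ℕ.≤ ⌈ a / d ⌉ ℕ.* d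
≤⌈/⌉* a d@(suc d-1) = ℕ.+-cancelʳ-≤ d-1 _ _ (begin
  a ℕ.+ d-1                                        ≡⟨ ℕ.m≡m%n+[m/n]*n (a ℕ.+ d-1) d ⟩
  (a ℕ.+ d-1) ℕ.% d ℕ.+ ⌈ a / d ⌉ ℕ.* d            ≤⟨ ℕ.+-monoˡ-≤ _ (ℕ.≤-pred (ℕ.m%n<n (a ℕ.+ d-1) d)) ⟩
  d-1 ℕ.+ ⌈ a / d ⌉ ℕ.* d                          ≡⟨ ℕ.+-comm d-1 _ ⟩
  ⌈ a / d ⌉ ℕ.* d ℕ.+ d-1                          ∎)
  where open ℕ.≤-Reasoning

⌈/⌉*< : ∀ a d .{{_ : NonZero d}} → ⌈ a / d ⌉ ℕ.* d ℕ.< a ℕ.+ d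
⌈/⌉*< a d@(suc d-1) = subst (⌈ a / d ⌉ ℕ.* d ℕ.<_) (sym (ℕ.+-suc a d-1))
  (s≤s (ℕ.m/n*n≤m (a ℕ.+ d-1) d))

⌈/⌉-least : ∀ a d N .{{_ : NonZero d}} → a ℕ.≤ N ℕ.* d → ⌈ a / d ⌉ ℕ.≤ N
⌈/⌉-least a d N a≤Nd = ℕ.≤-pred (ℕ.*-cancelʳ-< d ⌈ a / d ⌉ (suc N) (begin-strict
  ⌈ a / d ⌉ ℕ.* d  <⟨ ⌈/⌉*< a d ⟩
  a ℕ.+ d          ≤⟨ ℕ.+-monoˡ-≤ d a≤Nd ⟩
  N ℕ.* d ℕ.+ d    ≡⟨ ℕ.+-comm _ d ⟩
  suc N ℕ.* d      ∎))
  where open ℕ.≤-Reasoning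

greatest : ∀ {P : Pred ℕ 0ℓ} → Decidable P → P 0 → ∀ M →
           ∃ λ k → k ℕ.≤ M × P k × (∀ j → j ℕ.≤ M → P j → j ℕ.≤ k)
greatest P? P0 zero = 0 , z≤n , P0 , λ j j≤0 _ → j≤0
greatest P? P0 (suc M) with P? (suc M)
... | yes PM = suc M , ℕ.≤-refl , PM , λ j j≤M _ → j≤M
... | no ¬PM with k , k≤M , Pk , max ← greatest P? P0 M =
  k , ℕ.m≤n⇒m≤1+n k≤M , Pk , λ j j≤1+M Pj →
    max j (ℕ.≤-pred (ℕ.≤∧≢⇒< j≤1+M λ { refl → ¬PM Pj })) Pj

Σℕ : ℕ → (ℕ → ℕ) → ℕ
Σℕ zero    c = 0
Σℕ (suc ℓ) c = Σℕ ℓ c ℕ.+ c (suc ℓ)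

Σ₁-+ : ∀ ℓ c → Σ₁ ℓ (λ t → + c t) ≡ + Σℕ ℓ c
Σ₁-+ zero    c = refl
Σ₁-+ (suc ℓ) c = cong (ℤ._+ + c (suc ℓ)) (Σ₁-+ ℓ c)

Σ₁-mono : ∀ ℓ {f g} → (∀ t .{{_ : NonZero t}} → t ℕ.≤ ℓ → f t ℤ.≤ g t) →
          Σ₁ ℓ f ℤ.≤ Σ₁ ℓ g
Σ₁-mono zero    f≤g = ℤ.≤-refl
Σ₁-mono (suc ℓ) f≤g =
  ℤ.+-mono-≤ (Σ₁-mono ℓ λ t t≤ℓ → f≤g t (ℕ.m≤n⇒m≤1+n t≤ℓ)) (f≤g (suc ℓ) ℕ.≤-refl)

-- The largest feasible value as a fraction over (n!)².

module Optimum (n : ℕ) (n≥1 : n ℕ.≥ 1) where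

  M : ℕ
  M = (n !) ^ 2

  instance
    n!≢0 : NonZero (n !)
    n!≢0 = n ℕ.!≢0
    M≢0 : NonZero M
    M≢0 = ℕ.m^n≢0 (n !) 2

  t²∣M : ∀ t .{{_ : NonZero t}} → t ℕ.≤ n → t ^ 2 ∣ M
  t²∣M t@(suc t-1) t≤n = ^-mono-∣ (∣-trans (m∣m*n {t} (t-1 !)) (m≤n⇒m!∣n! t≤n))
    where
    ^-mono-∣ : ∀ {a b} → a ∣ b → a ^ 2 ∣ b ^ 2
    ^-mono-∣ {a} {b} a∣b = *-pres-∣ a∣b (*-pres-∣ a∣b (∣-refl {1}))

  -- This is ⌈z t²⌉ for z = k / M. Computed in ℕ, it makes feasibility of k / M decidable, which it
  -- is not for an arbitrary cut.
  c : ℕ → ℕ → ℕ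
  c k t = ⌈ k ℕ.* t ^ 2 / M ⌉

  Fits : ℕ → Set
  Fits k = ∀ {ℓ} → ℓ ℕ.< suc n → Σℕ ℓ (c k) ℕ.≤ ℓ ^ 2

  fits? : Decidable Fits
  fits? k = ℕ.allUpTo? (λ ℓ → Σℕ ℓ (c k) ℕ.≤? ℓ ^ 2) (suc n)

  fits-0 : Fits 0
  fits-0 {ℓ} _ = ℕ.≤-trans (ℕ.≤-reflexive (Σ≡0 ℓ)) z≤n
    where
    Σ≡0 : ∀ ℓ → Σℕ ℓ (c 0) ≡ 0
    Σ≡0 zero    = refl
    Σ≡0 (suc ℓ) = cong₂ ℕ._+_ (Σ≡0 ℓ) (ℕ.n≤0⇒n≡0 (⌈/⌉-least 0 M 0 z≤n))

  -- The constraint at ℓ = 1 reads ⌈k / M⌉ ≤ 1. It makes the search for `k⋆` finite and later gives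
  -- `atMostOne`.
  fits⇒≤M : ∀ k → Fits k → k ℕ.≤ M
  fits⇒≤M k fits = begin
    k                        ≡⟨ ℕ.*-identityʳ k ⟨
    k ℕ.* 1 ^ 2              ≤⟨ ≤⌈/⌉* (k ℕ.* 1 ^ 2) M ⟩
    c k 1 ℕ.* M              ≤⟨ ℕ.*-monoˡ-≤ M (fits (s≤s n≥1)) ⟩
    1 ℕ.* M                  ≡⟨ ℕ.*-identityˡ M ⟩
    M                        ∎
    where open ℕ.≤-Reasoning

  k⋆ : ℕ
  k⋆ = proj₁ (greatest fits? fits-0 M)

  k⋆-fits : Fits k⋆
  k⋆-fits = proj₁ (proj₂ (proj₂ (greatest fits? fits-0 M)))

  k⋆-greatest : ∀ k → Fits k → k ℕ.≤ k⋆
  k⋆-greatest k fits =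
    proj₂ (proj₂ (proj₂ (greatest fits? fits-0 M))) k (fits⇒≤M k fits) fits

  opt : ℚ
  opt = + k⋆ / M

  -- Since t² divides M, an integer k with k t² < N M + t² satisfies k t² ≤ N M.
  <-optimum : ∀ q (N : ℕ → ℤ) →
    (∀ t (t≢0 : NonZero t) → t ℕ.≤ n → q ℚ.< (N t / t ^ 2) {{ℕ.m^n≢0 t 2 {{t≢0}}}}) →
    (∀ ℓ → NonZero ℓ → ℓ ℕ.≤ n → Σ₁ ℓ N ℤ.≤ + (ℓ ^ 2)) →
    q ℚ.< opt
  <-optimum q@(mkℚ (-[1+ _ ]) _ _) _ _ _ =
    ℚ.<-≤-trans (ℚ.negative⁻¹ q) (ℚ.nonNegative⁻¹ opt {{ℚ.normalize-nonNeg k⋆ M}})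
  <-optimum q@(mkℚ (+ a) d-1 _) N q<N ΣN≤ = ℚ.<-≤-trans
    (cross-</ q (+ k) M (subst₂ ℤ._<_ (ℤ.pos-* a M) (ℤ.pos-* k d) (ℤ.+<+ aM<kd)))
    (/-mono-≤ (+ k) M (+ k⋆) M
      (ℤ.*-monoʳ-≤-nonNeg (+ M) (ℤ.+≤+ (k⋆-greatest k fits))))
    where
    d k : ℕ
    d = suc d-1
    -- The least numerator with q < k / M. Once `k` is shown to fit, q < k / M ≤ k⋆ / M.
    k = suc (a ℕ.* M ℕ./ d)
    aM<kd : a ℕ.* M ℕ.< k ℕ.* d
    aM<kd = begin-strict
      a ℕ.* M                                        ≡⟨ ℕ.m≡m%n+[m/n]*n (a ℕ.* M) d ⟩
      (a ℕ.* M) ℕ.% d ℕ.+ a ℕ.* M ℕ./ d ℕ.* d        <⟨ ℕ.+-monoˡ-< _ (ℕ.m%n<n (a ℕ.* M) d) ⟩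
      k ℕ.* d                                        ∎
      where open ℕ.≤-Reasoning
    c≤N : ∀ t .{{_ : NonZero t}} → t ℕ.≤ n → + c k t ℤ.≤ N t
    c≤N t@(suc t-1) t≤n
      with N t | </-cross q (N t) (t ^ 2) {{ℕ.m^n≢0 t 2}} (q<N t _ t≤n) | t²∣M t t≤n
    -- Here q ≥ 0 and q < N t / t², so N t cannot be negative.
    ... | -[1+ _ ] | lt | _ = contradiction
            (ℤ.≤-<-trans (ℤ.≤-trans (ℤ.+≤+ z≤n) (ℤ.≤-reflexive (ℤ.pos-* a (t ^ 2)))) lt) λ ()
    ... | + N′ | lt | divides s M≡st² = ℤ.+≤+ (⌈/⌉-least (k ℕ.* t ^ 2) M N′ (begin
            k ℕ.* t ^ 2            ≤⟨ ℕ.*-monoˡ-≤ (t ^ 2) k≤N′s ⟩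
            N′ ℕ.* s ℕ.* t ^ 2     ≡⟨ ℕ.*-assoc N′ s (t ^ 2) ⟩
            N′ ℕ.* (s ℕ.* t ^ 2)   ≡⟨ cong (N′ ℕ.*_) M≡st² ⟨
            N′ ℕ.* M               ∎))
      where
      open ℕ.≤-Reasoning
      at²<N′d : a ℕ.* t ^ 2 ℕ.< N′ ℕ.* d
      at²<N′d = ℤ.drop‿+<+ (subst₂ ℤ._<_ (sym (ℤ.pos-* a (t ^ 2))) (sym (ℤ.pos-* N′ d)) lt)
      instance
        s≢0 : NonZero s
        s≢0 = ℕ.≢-nonZero λ { refl → ℕ.≢-nonZero⁻¹ M M≡st² }
      -- Multiplying a t² < N′ d by s gives a M < N′ s d. The integer N′ s therefore exceeds the
      -- quotient of a M by d, and the strictness pays for the successor in `k`.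
      k≤N′s : k ℕ.≤ N′ ℕ.* s
      k≤N′s = ℕ.m<n*o⇒m/o<n (begin-strict
        a ℕ.* M                   ≡⟨ cong (a ℕ.*_) (trans M≡st² (ℕ.*-comm s (t ^ 2))) ⟩
        a ℕ.* (t ^ 2 ℕ.* s)       ≡⟨ ℕ.*-assoc a (t ^ 2) s ⟨
        a ℕ.* t ^ 2 ℕ.* s         <⟨ ℕ.*-monoˡ-< s at²<N′d ⟩
        N′ ℕ.* d ℕ.* s            ≡⟨ ℕ.*-assoc N′ d s ⟩
        N′ ℕ.* (d ℕ.* s)          ≡⟨ cong (N′ ℕ.*_) (ℕ.*-comm d s) ⟩
        N′ ℕ.* (s ℕ.* d)          ≡⟨ ℕ.*-assoc N′ s d ⟨
        N′ ℕ.* s ℕ.* d            ∎)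
    fits : Fits k
    fits {zero}      _          = z≤n
    fits {ℓ@(suc _)} (s≤s ℓ≤n) = ℤ.drop‿+≤+ (begin
      + Σℕ ℓ (c k)              ≡⟨ Σ₁-+ ℓ (c k) ⟨
      Σ₁ ℓ (λ t → + c k t)      ≤⟨ Σ₁-mono ℓ (λ t t≤ℓ → c≤N t (ℕ.≤-trans t≤ℓ ℓ≤n)) ⟩
      Σ₁ ℓ N                    ≤⟨ ΣN≤ ℓ _ ℓ≤n ⟩
      + (ℓ ^ 2)                 ∎)
      where open ℤ.≤-Reasoning

  opt≤c/t² : ∀ t .{{_ : NonZero t}} → opt ℚ.≤ (+ c k⋆ t / t ^ 2) {{ℕ.m^n≢0 t 2}}
  opt≤c/t² t = /-mono-≤ (+ k⋆) M (+ c k⋆ t) (t ^ 2) {{M≢0}} {{ℕ.m^n≢0 t 2}}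
    (subst₂ ℤ._≤_ (ℤ.pos-* k⋆ (t ^ 2)) (ℤ.pos-* (c k⋆ t) M)
      (ℤ.+≤+ (≤⌈/⌉* (k⋆ ℕ.* t ^ 2) M)))

  [c-1]/t²<opt : ∀ t .{{_ : NonZero t}} → ((+ c k⋆ t ℤ.- + 1) / t ^ 2) {{ℕ.m^n≢0 t 2}} ℚ.< opt
  [c-1]/t²<opt t = /-mono-< (+ c k⋆ t ℤ.- + 1) (t ^ 2) (+ k⋆) M {{ℕ.m^n≢0 t 2}} {{M≢0}} (begin-strict
    (+ c k⋆ t ℤ.- + 1) ℤ.* + M           ≡⟨ ℤ.*-distribʳ-+ (+ M) (+ c k⋆ t) (ℤ.- + 1) ⟩
    + c k⋆ t ℤ.* + M ℤ.+ ℤ.- + 1 ℤ.* + M ≡⟨ cong₂ ℤ._+_ (sym (ℤ.pos-* (c k⋆ t) M)) (ℤ.-1*i≡-i (+ M)) ⟩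
    + (c k⋆ t ℕ.* M) ℤ.- + M             <⟨ ℤ.+-monoˡ-< (ℤ.- + M) (ℤ.+<+ (⌈/⌉*< (k⋆ ℕ.* t ^ 2) M)) ⟩
    + (k⋆ ℕ.* t ^ 2 ℕ.+ M) ℤ.- + M       ≡⟨ ℤ.+-assoc (+ (k⋆ ℕ.* t ^ 2)) (+ M) (ℤ.- + M) ⟩
    + (k⋆ ℕ.* t ^ 2) ℤ.+ (+ M ℤ.- + M)   ≡⟨ cong (ℤ._+_ (+ (k⋆ ℕ.* t ^ 2))) (ℤ.+-inverseʳ (+ M)) ⟩
    + (k⋆ ℕ.* t ^ 2) ℤ.+ + 0             ≡⟨ ℤ.+-identityʳ _ ⟩
    + (k⋆ ℕ.* t ^ 2)                     ≡⟨ ℤ.pos-* k⋆ (t ^ 2) ⟩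
    + k⋆ ℤ.* + (t ^ 2)                   ∎)
    where open ℤ.≤-Reasoning

  opt-feasible : Feasible n (fromℚ opt)
  opt-feasible = record
    { nonNegative = fromℚ-mono (ℚ.nonNegative⁻¹ opt {{ℚ.normalize-nonNeg k⋆ M}})
    ; atMostOne   = fromℚ-mono (/-mono-≤ (+ k⋆) M (+ 1) 1
        (subst₂ ℤ._≤_ (sym (ℤ.*-identityʳ (+ k⋆))) (sym (ℤ.*-identityˡ (+ M)))
          (ℤ.+≤+ (fits⇒≤M k⋆ k⋆-fits))))
    ; ⌈z·_²⌉      = λ t → + c k⋆ t
    ; isCeiling   = λ t _ → fromℚ-isCeiling opt (+ c k⋆ t) (t ^ 2) {{ℕ.m^n≢0 t 2}}
        ([c-1]/t²<opt t) (opt≤c/t² t)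
    ; sum≤        = λ ℓ ℓ≤n → subst (ℤ._≤ + (ℓ ^ 2)) (sym (Σ₁-+ ℓ (c k⋆)))
        (ℤ.+≤+ (k⋆-fits (s≤s ℓ≤n)))
    }

  -- For maximality, each rational q below a feasible z satisfies q < ⌈z t²⌉ / t², so `<-optimum`
  -- applies with the ceilings of z as `N`.
  opt-isMax : IsMax (Feasible n) (fromℚ opt)
  opt-isMax = opt-feasible , λ z feasible q Lq →
    let open Feasible feasible in
    <-optimum q ⌈z·_²⌉
      (λ t t≢0 t≤n → ·-≤-fromℤ z (⌈z·_²⌉ t) (t ^ 2) {{ℕ.m^n≢0 t 2 {{t≢0}}}}
        (proj₂ (isCeiling t {{t≢0}} t≤n)) q Lq)
      (λ ℓ ℓ≢0 → sum≤ ℓ {{ℓ≢0}})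

-- Counting with duplicate-free lists, and the list of all signal vectors.

Unique-⊆⇒length≤ : ∀ {A : Set} {xs ys : List A} → Unique xs → xs ⊆ ys → length xs ℕ.≤ length ys
Unique-⊆⇒length≤ [] _ = z≤n
Unique-⊆⇒length≤ {xs = x ∷ xs} (x∉xs ∷ uniq) sub with as , bs , refl ← ∈-∃++ (sub (here refl)) = begin
  suc (length xs)                   ≤⟨ s≤s (Unique-⊆⇒length≤ uniq sub′) ⟩
  suc (length (as ++ bs))           ≡⟨ cong suc (List.length-++ as) ⟩
  suc (length as ℕ.+ length bs)     ≡⟨ ℕ.+-suc (length as) (length bs) ⟨
  length as ℕ.+ suc (length bs)     ≡⟨ List.length-++ as ⟨
  length (as ++ x ∷ bs)             ∎
  where
  open ℕ.≤-Reasoning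
  -- Deleting one occurrence of x from the larger list keeps all of xs in it, because x does not
  -- recur in xs.
  sub′ : xs ⊆ as ++ bs
  sub′ y∈xs with ∈-++⁻ as (sub (there y∈xs))
  ... | inj₁ y∈as         = ∈-++⁺ˡ y∈as
  ... | inj₂ (here refl)  = contradiction refl (All.lookup x∉xs y∈xs)
  ... | inj₂ (there y∈bs) = ∈-++⁺ʳ as y∈bs

length-cartesianProductWith : ∀ {A B C : Set} (f : A → B → C) xs ys →
  length (List.cartesianProductWith f xs ys) ≡ length xs ℕ.* length ys
length-cartesianProductWith f []       ys = refl
length-cartesianProductWith f (x ∷ xs) ys = trans (List.length-++ (map (f x) ys))
  (cong₂ ℕ._+_ (List.length-map (f x) ys) (length-cartesianProductWith f xs ys))

length-allVecs : ∀ k m → length (allVecs k m) ≡ k ^ m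
length-allVecs k zero    = refl
length-allVecs k (suc m) = trans (length-cartesianProductWith Vec._∷_ (List.allFin k) (allVecs k m))
  (cong₂ ℕ._*_ (List.length-tabulate {n = k} (λ i → i)) (length-allVecs k m))

∈-allVecs : ∀ {k m} (v : Vec (Fin k) m) → v ∈ allVecs k m
∈-allVecs Vec.[]      = here refl
∈-allVecs (x Vec.∷ v) = ∈-cartesianProductWith⁺ Vec._∷_ (∈-allFin x) (∈-allVecs v)

Unique-allVecs : ∀ k m → Unique (allVecs k m)
Unique-allVecs k zero    = All.[] ∷ []
Unique-allVecs k (suc m) = Unique.cartesianProductWith⁺ Vec._∷_ Vec.∷-injective
  (Unique.allFin⁺ k) (Unique-allVecs k m)

count-map : ∀ {A B : Set} {P : Pred B 0ℓ} (P? : Decidable P) (f : A → B) {m} (v : Vec A m) →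
            count P? (Vec.map f v) ≡ count (P? ∘ f) v
count-map P? f Vec.[] = refl
count-map P? f (x Vec.∷ v) with does (P? (f x))
... | true  = cong suc (count-map P? f v)
... | false = count-map P? f v

map-toℕ-injective : ∀ {k m} {v w : Vec (Fin k) m} → Vec.map toℕ v ≡ Vec.map toℕ w → v ≡ w
map-toℕ-injective {v = Vec.[]}    {Vec.[]}    _  = refl
map-toℕ-injective {v = x Vec.∷ v} {y Vec.∷ w} eq =
  let x≡y , v≡w = Vec.∷-injective eq in
  cong₂ Vec._∷_ (Fin.toℕ-injective x≡y) (map-toℕ-injective v≡w)

All-<⇒∈-allVecs : ∀ {k m} {v : Vec ℕ m} → VecAll.All (ℕ._< k) v →
                  v ∈ map (Vec.map toℕ) (allVecs k m)
All-<⇒∈-allVecs {k} v<k =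
  let w , w≡v = lift v<k in subst (_∈ _) w≡v (∈-map⁺ (Vec.map toℕ) (∈-allVecs w))
  where
  lift : ∀ {m} {v : Vec ℕ m} → VecAll.All (ℕ._< k) v → ∃ λ w → Vec.map toℕ w ≡ v
  lift []           = Vec.[] , refl
  lift (x<k ∷ v<k) = let w , w≡v = lift v<k in
    fromℕ< x<k Vec.∷ w , cong₂ Vec._∷_ (Fin.toℕ-fromℕ< x<k) w≡v

map-toℕ-< : ∀ {k m} (v : Vec (Fin k) m) → VecAll.All (ℕ._< k) (Vec.map toℕ v)
map-toℕ-< Vec.[]      = []
map-toℕ-< (x Vec.∷ v) = Fin.toℕ<n x ∷ map-toℕ-< v

-- Upper bound: increasing instances and disjoint winning sets.

increasing : ∀ {n} → Fin n → Instance n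
increasing {n} i = record { value = value ; i⋆ = i ; uniqueMax = uniqueMax }
  where
  value : Fin n → ℕ
  value j with j ≤ᶠ? i
  ... | yes _ = suc (toℕ j)
  ... | no _  = 0
  uniqueMax : ∀ j → j ≢ i → value j ℕ.< value i
  uniqueMax j j≢i with i ≤ᶠ? i | j ≤ᶠ? i
  ... | no i≰i | _       = contradiction ℕ.≤-refl i≰i
  ... | yes _  | yes j≤i = s≤s (Fin.≤∧≢⇒< j≤i j≢i)
  ... | yes _  | no _    = s≤s z≤n

increasing-value : ∀ {n} (i j : Fin n) → j ≤ᶠ i → Instance.value (increasing i) j ≡ suc (toℕ j)
increasing-value i j j≤i with j ≤ᶠ? i
... | yes _  = refl
... | no j≰i = contradiction j≤i j≰i

-- Signals are mapped to ℕ so that the winning vectors of instances with different horizons live in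
-- one type and can be compared.
successes : ∀ {n} (m : ℕ) (π : Policy n) (I : Instance n) → List (Vec ℕ m)
successes m π I = map (Vec.map toℕ) (filter (succeeds? I π) (allVecs (Instance.horizon I) m))

module UpperBound {n : ℕ} (m : ℕ) (π : Policy n) where

  commonHistory : Vec ℕ m → (t : Fin n) → Vec Observation (suc (toℕ t))
  commonHistory v t = tabulate λ s → suc (toℕ s) , count (ℕ._≟ toℕ s) v

  -- Up to the maximum, the value at j is j + 1 whatever `i` is, and the counts depend on the
  -- signals alone. Hence the policy cannot tell the increasing instances apart in time.
  history-increasing : ∀ i (S : Signals (increasing i) m) t → t ≤ᶠ i →
                       history (increasing i) S t ≡ commonHistory (Vec.map toℕ S) t
  history-increasing i S t t≤i = Vec.tabulate-cong λ s → cong₂ _,_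
    (trans
      (increasing-value i _ (subst (ℕ._≤ toℕ i) (sym (Fin.toℕ-inject≤ s (Fin.toℕ<n t)))
        (ℕ.≤-trans (ℕ.≤-pred (Fin.toℕ<n s)) t≤i)))
      (cong suc (Fin.toℕ-inject≤ s _)))
    (sym (count-map (ℕ._≟ toℕ s) toℕ S))

  Stops : Vec ℕ m → Fin n → Set
  Stops v t = π t (commonHistory v t) ≡ true × (∀ s → s <ᶠ t → π s (commonHistory v s) ≡ false)

  -- The source of disjointness: a fixed signal vector yields one sequence of common histories, and
  -- this has at most one first stop.
  Stops-unique : ∀ v {t u} → Stops v t → Stops v u → t ≡ u
  Stops-unique v {t} {u} (stop-t , wait-t) (stop-u , wait-u) with Fin.<-cmp t u
  ... | tri≈ _ t≡u _ = t≡u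
  ... | tri< t<u _ _ = contradiction (trans (sym stop-t) (wait-u t t<u)) λ ()
  ... | tri> _ _ u<t = contradiction (trans (sym stop-u) (wait-t u u<t)) λ ()

  Succeeds⇒Stops : ∀ i S → Succeeds (increasing i) π S → Stops (Vec.map toℕ S) i
  Succeeds⇒Stops i S (stop , wait) =
    subst (λ h → π i h ≡ true) (history-increasing i S i ℕ.≤-refl) stop ,
    λ s s<i → subst (λ h → π s h ≡ false) (history-increasing i S s (ℕ.<⇒≤ s<i)) (wait s s<i)

  ∈-successes : ∀ i {v} → v ∈ successes m π (increasing i) →
                VecAll.All (ℕ._< suc (toℕ i)) v × Stops v i
  ∈-successes i v∈ with S , S∈ , refl ← ∈-map⁻ (Vec.map toℕ) v∈ =
    map-toℕ-< S , Succeeds⇒Stops i S (proj₂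
      (∈-filter⁻ (succeeds? (increasing i) π) {xs = allVecs _ m} S∈))

  -- Indexed by ℕ, with the empty list as default from `n` on, so that wins can be accumulated by
  -- recursion on ℓ.
  wins : ℕ → List (Vec ℕ m)
  wins i with i ℕ.<? n
  ... | yes i<n = successes m π (increasing (fromℕ< i<n))
  ... | no _    = []

  wins-toℕ : ∀ i → wins (toℕ i) ≡ successes m π (increasing i)
  wins-toℕ i with toℕ i ℕ.<? n
  ... | yes i<n = cong (successes m π ∘ increasing) (Fin.fromℕ<-toℕ i i<n)
  ... | no i≮n  = contradiction (Fin.toℕ<n i) i≮n

  ∈-wins : ∀ i {v} → v ∈ wins i →
           VecAll.All (ℕ._< suc i) v × (∃ λ t → toℕ t ≡ i × Stops v t)
  ∈-wins i v∈ with i ℕ.<? n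
  ... | yes i<n =
    let v<i , stops = ∈-successes (fromℕ< i<n) v∈ in
    subst (λ j → VecAll.All (ℕ._< suc j) _) (Fin.toℕ-fromℕ< i<n) v<i ,
    fromℕ< i<n , Fin.toℕ-fromℕ< i<n , stops

  Unique-wins : ∀ i → Unique (wins i)
  Unique-wins i with i ℕ.<? n
  ... | yes i<n = Unique.map⁺ map-toℕ-injective
                    (Unique.filter⁺ (succeeds? (increasing (fromℕ< i<n)) π) (Unique-allVecs _ m))
  ... | no _    = []

  allWins : ℕ → List (Vec ℕ m)
  allWins zero    = []
  allWins (suc ℓ) = allWins ℓ ++ wins ℓ

  ∈-allWins : ∀ ℓ {v} → v ∈ allWins ℓ → ∃ λ i → i ℕ.< ℓ × v ∈ wins i
  ∈-allWins (suc ℓ) v∈ with ∈-++⁻ (allWins ℓ) v∈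
  ... | inj₁ v∈ˡ = let i , i<ℓ , v∈wins = ∈-allWins ℓ v∈ˡ in i , ℕ.m<n⇒m<1+n i<ℓ , v∈wins
  ... | inj₂ v∈ʳ = ℓ , ℕ.≤-refl , v∈ʳ

  Unique-allWins : ∀ ℓ → Unique (allWins ℓ)
  Unique-allWins zero    = []
  Unique-allWins (suc ℓ) = Unique.++⁺ (Unique-allWins ℓ) (Unique-wins ℓ) λ {v} (v∈ˡ , v∈ʳ) →
    let i , i<ℓ , v∈        = ∈-allWins ℓ v∈ˡ
        _ , t , t≡i , stops  = ∈-wins i v∈
        _ , u , u≡ℓ , stops′ = ∈-wins ℓ v∈ʳ
    in ℕ.<⇒≢ i<ℓ (trans (sym t≡i) (trans (cong toℕ (Stops-unique v stops stops′)) u≡ℓ))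

  -- A win at index i < ℓ has all its signals below suc i ≤ ℓ, so the accumulated wins are distinct
  -- elements of a set of ℓ ^ m vectors.
  length-allWins : ∀ ℓ → length (allWins ℓ) ℕ.≤ ℓ ^ m
  length-allWins ℓ = begin
    length (allWins ℓ)                              ≤⟨ Unique-⊆⇒length≤ (Unique-allWins ℓ) allWins⊆ ⟩
    length (map (Vec.map toℕ) (allVecs ℓ m))        ≡⟨ List.length-map _ (allVecs ℓ m) ⟩
    length (allVecs ℓ m)                            ≡⟨ length-allVecs ℓ m ⟩
    ℓ ^ m                                           ∎
    where
    open ℕ.≤-Reasoning
    allWins⊆ : allWins ℓ ⊆ map (Vec.map toℕ) (allVecs ℓ m)
    allWins⊆ v∈ = let i , i<ℓ , v∈wins = ∈-allWins ℓ v∈ in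
      All-<⇒∈-allVecs (VecAll.map (λ x≤i → ℕ.<-≤-trans x≤i i<ℓ) (proj₁ (∈-wins i v∈wins)))

  winCount : ℕ → ℤ
  winCount zero    = + 0
  winCount (suc i) = + length (wins i)

  Σ₁-winCount : ∀ ℓ → Σ₁ ℓ winCount ≡ + length (allWins ℓ)
  Σ₁-winCount zero    = refl
  Σ₁-winCount (suc ℓ) = trans (cong (ℤ._+ winCount (suc ℓ)) (Σ₁-winCount ℓ))
    (cong +_ (sym (List.length-++ (allWins ℓ))))

  Σ₁-winCount≤ : ∀ ℓ → Σ₁ ℓ winCount ℤ.≤ + (ℓ ^ m)
  Σ₁-winCount≤ ℓ = subst (ℤ._≤ + (ℓ ^ m)) (sym (Σ₁-winCount ℓ)) (ℤ.+≤+ (length-allWins ℓ))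

  winCount-increasing : ∀ i → winCount (suc (toℕ i)) ≡
    + length (filter (succeeds? (increasing i) π) (allVecs (suc (toℕ i)) m))
  winCount-increasing i = cong +_ (trans (cong length (wins-toℕ i))
    (List.length-map (Vec.map toℕ)
      (filter (succeeds? (increasing i) π) (allVecs (suc (toℕ i)) m))))

-- Recovering an unordered signal pair from its counts.

module _ {A : Set} {P : Pred A 0ℓ} (P? : Decidable P) where

  count-accept : ∀ x {m} (v : Vec A m) → P x → count P? (x ∷ v) ≡ suc (count P? v)
  count-accept x v Px with P? x
  ... | yes _  = refl
  ... | no ¬Px = contradiction Px ¬Px

  count-reject : ∀ x {m} (v : Vec A m) → ¬ P x → count P? (x ∷ v) ≡ count P? v
  count-reject x v ¬Px with P? x
  ... | yes Px = contradiction Px ¬Px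
  ... | no _   = refl

  count-cancel : ∀ x {m} (v w : Vec A m) →
                 count P? (x ∷ v) ≡ count P? (x ∷ w) → count P? v ≡ count P? w
  count-cancel x v w eq with P? x
  ... | yes _ = ℕ.suc-injective eq
  ... | no _  = eq

  count-swap : ∀ x y {m} (v : Vec A m) → count P? (x ∷ y ∷ v) ≡ count P? (y ∷ x ∷ v)
  count-swap x y v with P? x | P? y
  ... | yes _ | yes _ = refl
  ... | yes _ | no _  = refl
  ... | no _  | yes _ = refl
  ... | no _  | no _  = refl

count-singleton : ∀ y b → count (ℕ._≟ b) (y ∷ []) ≡ count (ℕ._≟ b) (b ∷ []) → y ≡ b
count-singleton y b eq with y ℕ.≟ b
... | yes y≡b = y≡b
... | no y≢b  = contradiction
  (trans (sym (count-reject (ℕ._≟ b) y [] y≢b)) (trans eq (count-accept (ℕ._≟ b) b [] refl))) λ ()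

-- The count at a is positive, so x or y equals a. Cancelling that signal leaves one signal on each
-- side, and the count at b identifies it.
counts-determine-pair : ∀ x y a b →
  count (ℕ._≟ a) (x ∷ y ∷ []) ≡ count (ℕ._≟ a) (a ∷ b ∷ []) →
  count (ℕ._≟ b) (x ∷ y ∷ []) ≡ count (ℕ._≟ b) (a ∷ b ∷ []) →
  (x ≡ a × y ≡ b) ⊎ (x ≡ b × y ≡ a)
counts-determine-pair x y a b eq-a eq-b with x ℕ.≟ a | y ℕ.≟ a
... | yes refl | _ = inj₁ (refl , count-singleton y b (count-cancel (ℕ._≟ b) a (y ∷ []) (b ∷ []) eq-b))
... | no _ | yes refl = inj₂
  (count-singleton x b (count-cancel (ℕ._≟ b) a (x ∷ []) (b ∷ [])
    (trans (count-swap (ℕ._≟ b) a x []) eq-b)) , refl)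
... | no x≢a | no y≢a = contradiction
  (trans (sym (trans (count-reject (ℕ._≟ a) x (y ∷ []) x≢a) (count-reject (ℕ._≟ a) y [] y≢a)))
         (trans eq-a (count-accept (ℕ._≟ a) a (b ∷ []) refl))) λ ()

-- Numbering the unordered pairs.

triangle : ℕ → ℕ
triangle zero    = 0
triangle (suc b) = triangle b ℕ.+ b

triangle-mono : ∀ {a b} → a ℕ.≤ b → triangle a ℕ.≤ triangle b
triangle-mono z≤n       = z≤n
triangle-mono (s≤s a≤b) = ℕ.+-mono-≤ (triangle-mono a≤b) a≤b

-- The square [t]² consists of `triangle t` unordered pairs, each in two orientations, and t
-- doubles.
triangle*2+ : ∀ t → triangle t ℕ.* 2 ℕ.+ t ≡ t ^ 2
triangle*2+ zero    = refl
triangle*2+ (suc t) = begin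
  (triangle t ℕ.+ t) ℕ.* 2 ℕ.+ suc t           ≡⟨ solve 2 (λ x y →
    (x :+ y) :* con 2 :+ (con 1 :+ y) := (x :* con 2 :+ y) :+ (y :* con 2 :+ con 1)) refl (triangle t) t ⟩
  (triangle t ℕ.* 2 ℕ.+ t) ℕ.+ (t ℕ.* 2 ℕ.+ 1) ≡⟨ cong (ℕ._+ (t ℕ.* 2 ℕ.+ 1)) (triangle*2+ t) ⟩
  t ^ 2 ℕ.+ (t ℕ.* 2 ℕ.+ 1)                    ≡⟨ solve 1 (λ y → y :^ 2 :+ (y :* con 2 :+ con 1) := (con 1 :+ y) :^ 2) refl t ⟩
  suc t ^ 2                                    ∎
  where
  open ≡-Reasoning
  open +-*-Solver

-- The pairs a < b in the order (0,1), (0,2), (1,2), (0,3), …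
pairAt : ℕ → ℕ × ℕ
pairAt zero    = 0 , 1
pairAt (suc p) with a , b ← pairAt p with suc a ℕ.≟ b
... | yes _ = 0 , suc b
... | no _  = suc a , b

low high : ℕ → ℕ
low  = proj₁ ∘ pairAt
high = proj₂ ∘ pairAt

low<high : ∀ p → low p ℕ.< high p
low<high zero    = s≤s z≤n
low<high (suc p) with a , b ← pairAt p | a<b ← low<high p with suc a ℕ.≟ b
... | yes _    = s≤s z≤n
... | no 1+a≢b = ℕ.≤∧≢⇒< a<b 1+a≢b

-- The position of {a, b} in the order of `pairAt`: the pairs with a smaller maximum fill the first
-- `triangle (a ⊔ b)` places. Using maximum and minimum makes it symmetric, which yields closure
-- under swapping.
rank : ℕ → ℕ → ℕ
rank a b = triangle (a ⊔ b) ℕ.+ a ⊓ b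

rank-comm : ∀ a b → rank a b ≡ rank b a
rank-comm a b = cong₂ (λ x y → triangle x ℕ.+ y) (ℕ.⊔-comm a b) (ℕ.⊓-comm a b)

triangle-high+low : ∀ p → triangle (high p) ℕ.+ low p ≡ p
triangle-high+low zero    = refl
triangle-high+low (suc p) with a , b ← pairAt p | eq ← triangle-high+low p with suc a ℕ.≟ b
-- At the end of a block b = suc a, so `triangle (suc b)` is triangle b + suc a, one more than the
-- previous position.
... | yes refl = trans (ℕ.+-identityʳ _) (trans (ℕ.+-suc (triangle b) a) (cong suc eq))
... | no _     = trans (ℕ.+-suc (triangle b) a) (cong suc eq)

rank-pairAt : ∀ p → rank (low p) (high p) ≡ p
rank-pairAt p = trans
  (cong₂ (λ x y → triangle x ℕ.+ y) (ℕ.m≤n⇒m⊔n≡n low≤high) (ℕ.m≤n⇒m⊓n≡m low≤high))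
  (triangle-high+low p)
  where
  low≤high = ℕ.<⇒≤ (low<high p)

-- If the larger entry were at least t, then p = triangle (high p) + low p would be at least
-- `triangle t`. Thus the greedy choice uses only signals that can already have occurred.
high<-triangle : ∀ {p t} → p ℕ.< triangle t → high p ℕ.< t
high<-triangle {p} {t} p<tri = ℕ.≰⇒> λ t≤high → ℕ.<⇒≱ p<tri (begin
  triangle t                     ≤⟨ triangle-mono t≤high ⟩
  triangle (high p)              ≤⟨ ℕ.m≤m+n _ (low p) ⟩
  triangle (high p) ℕ.+ low p    ≡⟨ triangle-high+low p ⟩
  p                              ∎)
  where open ℕ.≤-Reasoning

-- Lower bound: greedy stopping sets and the policy they define.

module LowerBound (n : ℕ) (c : ℕ → ℕ) (Σc≤ : ∀ {ℓ} → ℓ ℕ.≤ n → Σℕ ℓ c ℕ.≤ ℓ ^ 2) where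

  mutual
    usedPairs usedDoubles : ℕ → ℕ

    usedPairs zero    = 0
    usedPairs (suc i) = usedPairs i ℕ.+ newPairs i

    usedDoubles zero    = 0
    usedDoubles (suc i) = usedDoubles i ℕ.+ newDoubles i

    newPairs newDoubles : ℕ → ℕ
    newPairs i   = (c (suc i) ℕ./ 2) ⊓ (triangle (suc i) ℕ.∸ usedPairs i)
    newDoubles i = c (suc i) ℕ.∸ newPairs i ℕ.* 2

  newPairs*2≤c : ∀ i → newPairs i ℕ.* 2 ℕ.≤ c (suc i)
  newPairs*2≤c i = ℕ.≤-trans (ℕ.*-monoˡ-≤ 2 (ℕ.m⊓n≤m (c (suc i) ℕ./ 2) _)) (ℕ.m/n*n≤m (c (suc i)) 2)

  newPairs*2+newDoubles : ∀ i → newPairs i ℕ.* 2 ℕ.+ newDoubles i ≡ c (suc i)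
  newPairs*2+newDoubles i = ℕ.m+[n∸m]≡n (newPairs*2≤c i)

  used≡Σ : ∀ i → usedPairs i ℕ.* 2 ℕ.+ usedDoubles i ≡ Σℕ i c
  used≡Σ zero    = refl
  used≡Σ (suc i) = begin
    (usedPairs i ℕ.+ newPairs i) ℕ.* 2 ℕ.+ (usedDoubles i ℕ.+ newDoubles i)
      ≡⟨ solve 4 (λ u x d y →
           (u :+ x) :* con 2 :+ (d :+ y) := (u :* con 2 :+ d) :+ (x :* con 2 :+ y)) refl
           (usedPairs i) (newPairs i) (usedDoubles i) (newDoubles i) ⟩
    (usedPairs i ℕ.* 2 ℕ.+ usedDoubles i) ℕ.+ (newPairs i ℕ.* 2 ℕ.+ newDoubles i)
      ≡⟨ cong₂ ℕ._+_ (used≡Σ i) (newPairs*2+newDoubles i) ⟩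
    Σℕ i c ℕ.+ c (suc i) ∎
    where
    open ≡-Reasoning
    open +-*-Solver

  usedPairs≤ : ∀ i → usedPairs i ℕ.≤ triangle i
  usedPairs≤ zero    = z≤n
  usedPairs≤ (suc i) = begin
    usedPairs i ℕ.+ newPairs i                                  ≤⟨ ℕ.+-monoʳ-≤ (usedPairs i) (ℕ.m⊓n≤n (c (suc i) ℕ./ 2) _) ⟩
    usedPairs i ℕ.+ (triangle (suc i) ℕ.∸ usedPairs i)          ≡⟨ ℕ.m+[n∸m]≡n (ℕ.≤-trans (usedPairs≤ i) (ℕ.m≤m+n (triangle i) i)) ⟩
    triangle (suc i)                                            ∎
    where open ℕ.≤-Reasoning

  -- Either all pairs are exhausted, and the total bounds the doubles, or only
  -- a parity correction of at most one double is needed.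
  usedDoubles≤ : ∀ i → i ℕ.≤ n → usedDoubles i ℕ.≤ i
  usedDoubles≤ zero    _   = z≤n
  usedDoubles≤ (suc i) i<n with ℕ.⊓-sel (c (suc i) ℕ./ 2) (triangle (suc i) ℕ.∸ usedPairs i)
  ... | inj₁ eq = begin
    usedDoubles i ℕ.+ newDoubles i                                ≡⟨ cong (λ x → usedDoubles i ℕ.+ (c (suc i) ℕ.∸ x ℕ.* 2)) eq ⟩
    usedDoubles i ℕ.+ (c (suc i) ℕ.∸ c (suc i) ℕ./ 2 ℕ.* 2)       ≡⟨ cong (usedDoubles i ℕ.+_) (ℕ.m%n≡m∸m/n*n (c (suc i)) 2) ⟨
    usedDoubles i ℕ.+ c (suc i) ℕ.% 2                             ≤⟨ ℕ.+-mono-≤ (usedDoubles≤ i (ℕ.<⇒≤ i<n)) (ℕ.≤-pred (ℕ.m%n<n (c (suc i)) 2)) ⟩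
    i ℕ.+ 1                                                       ≡⟨ ℕ.+-comm i 1 ⟩
    suc i                                                         ∎
    where open ℕ.≤-Reasoning
  ... | inj₂ eq = ℕ.+-cancelˡ-≤ (triangle (suc i) ℕ.* 2) _ _ (begin
    triangle (suc i) ℕ.* 2 ℕ.+ usedDoubles (suc i)                ≡⟨ cong (λ x → x ℕ.* 2 ℕ.+ usedDoubles (suc i)) exhausted ⟨
    usedPairs (suc i) ℕ.* 2 ℕ.+ usedDoubles (suc i)               ≡⟨ used≡Σ (suc i) ⟩
    Σℕ (suc i) c                                                  ≤⟨ Σc≤ i<n ⟩
    suc i ^ 2                                                     ≡⟨ triangle*2+ (suc i) ⟨
    triangle (suc i) ℕ.* 2 ℕ.+ suc i                              ∎)
    where
    open ℕ.≤-Reasoning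
    exhausted : usedPairs (suc i) ≡ triangle (suc i)
    exhausted = trans (cong (usedPairs i ℕ.+_) eq)
      (ℕ.m+[n∸m]≡n (ℕ.≤-trans (usedPairs≤ i) (ℕ.m≤m+n (triangle i) i)))

  Used : ℕ → ℕ → ℕ → Set
  Used t a b = (a ≡ b × a ℕ.< usedDoubles t) ⊎ (a ≢ b × rank a b ℕ.< usedPairs t)

  used? : ∀ t a b → Dec (Used t a b)
  used? t a b =
    (a ℕ.≟ b ×-dec a ℕ.<? usedDoubles t) ⊎-dec (¬? (a ℕ.≟ b) ×-dec rank a b ℕ.<? usedPairs t)

  Used-sym : ∀ {t a b} → Used t a b → Used t b a
  Used-sym (inj₁ (refl , a<d)) = inj₁ (refl , a<d)
  Used-sym {t} {a} {b} (inj₂ (a≢b , r<u)) =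
    inj₂ (a≢b ∘ sym , subst (ℕ._< usedPairs t) (rank-comm a b) r<u)

  Used-suc : ∀ {t a b} → Used t a b → Used (suc t) a b
  Used-suc {t} (inj₁ (a≡b , a<d)) = inj₁ (a≡b , ℕ.<-≤-trans a<d (ℕ.m≤m+n (usedDoubles t) _))
  Used-suc {t} (inj₂ (a≢b , r<u)) = inj₂ (a≢b , ℕ.<-≤-trans r<u (ℕ.m≤m+n (usedPairs t) _))

  Used-mono : ∀ {s t a b} → s ℕ.≤′ t → Used s a b → Used t a b
  Used-mono ℕ.≤′-refl       used = used
  Used-mono (ℕ.≤′-step s≤t) used = Used-suc (Used-mono s≤t used)

  module _ (i : ℕ) where

    high≤i : ∀ {k} → k ℕ.< newPairs i → high (usedPairs i ℕ.+ k) ℕ.< suc i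
    high≤i k<x = high<-triangle (ℕ.<-≤-trans (ℕ.+-monoʳ-< (usedPairs i) k<x) (usedPairs≤ (suc i)))

    low≤i : ∀ {k} → k ℕ.< newPairs i → low (usedPairs i ℕ.+ k) ℕ.< suc i
    low≤i {k} k<x = ℕ.<-trans (low<high (usedPairs i ℕ.+ k)) (high≤i k<x)

    pair-used : ∀ {k} → k ℕ.< newPairs i →
                let p = usedPairs i ℕ.+ k in Used (suc i) (low p) (high p)
    pair-used {k} k<x = inj₂ (ℕ.<⇒≢ (low<high p) ,
      subst (ℕ._< usedPairs (suc i)) (sym (rank-pairAt p)) (ℕ.+-monoʳ-< (usedPairs i) k<x))
      where p = usedPairs i ℕ.+ k

    pair-fresh : ∀ k → let p = usedPairs i ℕ.+ k in ¬ Used i (low p) (high p)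
    pair-fresh k (inj₁ (low≡high , _)) = ℕ.<⇒≢ (low<high (usedPairs i ℕ.+ k)) low≡high
    pair-fresh k (inj₂ (_ , rank<u))   = ℕ.m+n≮m (usedPairs i) k
      (subst (ℕ._< usedPairs i) (rank-pairAt (usedPairs i ℕ.+ k)) rank<u)

  -- Reads only the counts of the history, never the values: (a , b) is a candidate for the signals
  -- seen so far.
  Matches : ∀ {k} → Vec Observation k → Fin k → Fin k → Set
  Matches h a b = ∀ j → proj₂ (lookup h j) ≡ count (λ s → toℕ s ℕ.≟ toℕ j) (a ∷ b ∷ [])

  -- Tests membership in the union of the sets up to the current time. The union grows with time, so
  -- the first stop comes exactly when the pair enters it.
  UsedBy : (t : Fin n) → Vec Observation (suc (toℕ t)) → Set
  UsedBy t h = ∃ λ a → ∃ λ b → Used (suc (toℕ t)) (toℕ a) (toℕ b) × Matches h a b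

  usedBy? : ∀ t h → Dec (UsedBy t h)
  usedBy? t h = Fin.any? λ a → Fin.any? λ b →
    used? (suc (toℕ t)) (toℕ a) (toℕ b) ×-dec
    Fin.all? λ j → proj₂ (lookup h j) ℕ.≟ count (λ s → toℕ s ℕ.≟ toℕ j) (a ∷ b ∷ [])

  abstract
    policy : Policy n
    policy t h = does (usedBy? t h)

    policy-stops : ∀ t h → UsedBy t h → policy t h ≡ true
    policy-stops t h = dec-true (usedBy? t h)

    policy-waits : ∀ t h → ¬ UsedBy t h → policy t h ≡ false
    policy-waits t h = dec-false (usedBy? t h)

  module _ (I : Instance n) where
    open Instance I

    i = toℕ i⋆

    lookup-history : ∀ {m} (S : Signals I m) t j →
      proj₂ (lookup (history I S t) j) ≡ count (λ s → toℕ s ℕ.≟ toℕ j) S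
    lookup-history S t j = cong proj₂
      (Vec.lookup∘tabulate (λ s → value (inject≤ s (Fin.toℕ<n t)) , signalsAt I S (toℕ s)) j)

    -- The counts at the candidate's own two positions pin the actual signals down up to order, even
    -- if the actual ones range over later times too; `Used-sym` absorbs the order.
    UsedBy-history : ∀ x y t → UsedBy t (history I (x ∷ y ∷ []) t) →
                     Used (suc (toℕ t)) (toℕ x) (toℕ y)
    UsedBy-history x y t (a , b , used , matches)
      with counts-determine-pair (toℕ x) (toℕ y) (toℕ a) (toℕ b) (eq a) (eq b)
      where
      eq : ∀ j → count (λ s → toℕ s ℕ.≟ toℕ j) (x ∷ y ∷ []) ≡
                 count (λ s → toℕ s ℕ.≟ toℕ j) (a ∷ b ∷ [])
      eq j = trans (sym (lookup-history (x ∷ y ∷ []) t j)) (matches j)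
    ... | inj₁ (x≡a , y≡b) = subst₂ (Used (suc (toℕ t))) (sym x≡a) (sym y≡b) used
    ... | inj₂ (x≡b , y≡a) = subst₂ (Used (suc (toℕ t))) (sym x≡b) (sym y≡a) (Used-sym used)

    policy-succeeds : ∀ x y → Used (suc i) (toℕ x) (toℕ y) → ¬ Used i (toℕ x) (toℕ y) →
                      Succeeds I policy (x ∷ y ∷ [])
    policy-succeeds x y used fresh =
      policy-stops i⋆ _ (x , y , used , lookup-history (x ∷ y ∷ []) i⋆) ,
      -- A stop at s would put the pair into `Used (suc s)`, which lies in `Used i` because suc s ≤
      -- i.
      λ s s<i → policy-waits s _ λ usedBy →
        fresh (Used-mono (ℕ.≤⇒≤′ s<i) (UsedBy-history x y s usedBy))

    ∈-successes-policy : ∀ {a b} → a ℕ.< suc i → b ℕ.< suc i →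
      Used (suc i) a b → ¬ Used i a b → (a ∷ b ∷ []) ∈ successes 2 policy I
    ∈-successes-policy {a} {b} a≤i b≤i used fresh =
      subst (_∈ successes 2 policy I) (cong₂ (λ a b → a ∷ b ∷ []) eq-a eq-b)
        (∈-map⁺ (Vec.map toℕ) (∈-filter⁺ (succeeds? I policy) (∈-allVecs (x ∷ y ∷ []))
          (policy-succeeds x y
            (subst₂ (Used (suc i)) (sym eq-a) (sym eq-b) used)
            (fresh ∘ subst₂ (Used i) eq-a eq-b))))
      where
      x y : Fin (suc i)
      x = fromℕ< a≤i
      y = fromℕ< b≤i
      eq-a = Fin.toℕ-fromℕ< a≤i
      eq-b = Fin.toℕ-fromℕ< b≤i

    newPair newPairᵒ newDouble : ℕ → Vec ℕ 2
    newPair   k = let p = usedPairs i ℕ.+ k in low p ∷ high p ∷ []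
    newPairᵒ  k = let p = usedPairs i ℕ.+ k in high p ∷ low p ∷ []
    newDouble k = let a = usedDoubles i ℕ.+ k in a ∷ a ∷ []

    -- An explicit list of the set A_t at t = suc i. Each new unordered pair appears in both
    -- orientations, whence its weight 2.
    newSuccesses : List (Vec ℕ 2)
    newSuccesses = applyUpTo newPair (newPairs i) ++ applyUpTo newPairᵒ (newPairs i)
                   ++ applyUpTo newDouble (newDoubles i)

    length-newSuccesses : length newSuccesses ≡ c (suc i)
    length-newSuccesses = begin
      length newSuccesses
        ≡⟨ List.length-++ (applyUpTo newPair x) ⟩
      length (applyUpTo newPair x) ℕ.+ length (applyUpTo newPairᵒ x ++ applyUpTo newDouble y)
        ≡⟨ cong (length (applyUpTo newPair x) ℕ.+_) (List.length-++ (applyUpTo newPairᵒ x)) ⟩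
      length (applyUpTo newPair x) ℕ.+ (length (applyUpTo newPairᵒ x) ℕ.+ length (applyUpTo newDouble y))
        ≡⟨ cong₂ ℕ._+_ (List.length-applyUpTo newPair x)
             (cong₂ ℕ._+_ (List.length-applyUpTo newPairᵒ x) (List.length-applyUpTo newDouble y)) ⟩
      x ℕ.+ (x ℕ.+ y)
        ≡⟨ solve 2 (λ x y → x :+ (x :+ y) := x :* con 2 :+ y) refl x y ⟩
      x ℕ.* 2 ℕ.+ y
        ≡⟨ newPairs*2+newDoubles i ⟩
      c (suc i) ∎
      where
      open ≡-Reasoning
      open +-*-Solver
      x = newPairs i
      y = newDoubles i

    rankᵛ : Vec ℕ 2 → ℕ
    rankᵛ (a ∷ b ∷ []) = rank a b

    rank-newPair : ∀ k → rankᵛ (newPair k) ≡ usedPairs i ℕ.+ k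
    rank-newPair k = rank-pairAt (usedPairs i ℕ.+ k)

    rank-newPairᵒ : ∀ k → rankᵛ (newPairᵒ k) ≡ usedPairs i ℕ.+ k
    rank-newPairᵒ k = trans (rank-comm (high p) (low p)) (rank-pairAt p)
      where p = usedPairs i ℕ.+ k

    -- Within the first two blocks the rank separates the entries, within the third the repeated
    -- signal does. The blocks are disjoint since their vectors are ascending, descending and
    -- constant.
    Unique-newSuccesses : Unique newSuccesses
    Unique-newSuccesses =
      Unique.++⁺ (Unique.applyUpTo⁺₁ newPair x λ {j} {k} j<k _ eq → ranks-≢ j<k
                   (trans (sym (rank-newPair j)) (trans (cong rankᵛ eq) (rank-newPair k))))
        (Unique.++⁺ (Unique.applyUpTo⁺₁ newPairᵒ x λ {j} {k} j<k _ eq → ranks-≢ j<k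
                      (trans (sym (rank-newPairᵒ j)) (trans (cong rankᵛ eq) (rank-newPairᵒ k))))
          (Unique.applyUpTo⁺₁ newDouble y λ {j} {k} j<k _ eq →
            ℕ.<⇒≢ j<k (ℕ.+-cancelˡ-≡ (usedDoubles i) j k (Vec.∷-injectiveˡ eq)))
          disjointᵒ)
        disjoint
      where
      x = newPairs i
      y = newDoubles i
      ranks-≢ : ∀ {j k} → j ℕ.< k → usedPairs i ℕ.+ j ≢ usedPairs i ℕ.+ k
      ranks-≢ {j} {k} j<k eq = ℕ.<⇒≢ j<k (ℕ.+-cancelˡ-≡ (usedPairs i) j k eq)
      Ascending Descending : Vec ℕ 2 → Set
      Ascending  (a ∷ b ∷ []) = a ℕ.< b
      Descending (a ∷ b ∷ []) = b ℕ.< a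
      ascending : ∀ {v} → v ∈ applyUpTo newPair x → Ascending v
      ascending v∈ with k , _ , refl ← ∈-applyUpTo⁻ newPair v∈ = low<high (usedPairs i ℕ.+ k)
      descending : ∀ {v} → v ∈ applyUpTo newPairᵒ x → Descending v
      descending v∈ with k , _ , refl ← ∈-applyUpTo⁻ newPairᵒ v∈ = low<high (usedPairs i ℕ.+ k)
      disjointᵒ : ∀ {v} → ¬ (v ∈ applyUpTo newPairᵒ x × v ∈ applyUpTo newDouble y)
      disjointᵒ (v∈ , v∈′) with descending v∈ | ∈-applyUpTo⁻ newDouble v∈′
      ... | a<a | _ , _ , refl = ℕ.<-irrefl refl a<a
      disjoint : ∀ {v} → ¬ (v ∈ applyUpTo newPair x × v ∈ applyUpTo newPairᵒ x ++ applyUpTo newDouble y)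
      disjoint {_ ∷ _ ∷ []} (v∈ , v∈′) with ascending v∈ | ∈-++⁻ (applyUpTo newPairᵒ x) v∈′
      ... | a<b | inj₁ v∈ᵒ = ℕ.<-asym a<b (descending v∈ᵒ)
      ... | a<b | inj₂ v∈ᵈ with _ , _ , refl ← ∈-applyUpTo⁻ newDouble v∈ᵈ = ℕ.<-irrefl refl a<b

    newSuccesses⊆ : i ℕ.< n → newSuccesses ⊆ successes 2 policy I
    newSuccesses⊆ i<n {v} v∈ with ∈-++⁻ (applyUpTo newPair (newPairs i)) v∈
    ... | inj₁ v∈ˡ with k , k<x , refl ← ∈-applyUpTo⁻ newPair v∈ˡ =
      ∈-successes-policy (low≤i i k<x) (high≤i i k<x) (pair-used i k<x) (pair-fresh i k)
    ... | inj₂ v∈ʳ with ∈-++⁻ (applyUpTo newPairᵒ (newPairs i)) v∈ʳ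
    ...   | inj₁ v∈ᵒ with k , k<x , refl ← ∈-applyUpTo⁻ newPairᵒ v∈ᵒ =
      ∈-successes-policy (high≤i i k<x) (low≤i i k<x)
        (Used-sym (pair-used i k<x)) (pair-fresh i k ∘ Used-sym {i})
    ...   | inj₂ v∈ᵈ with k , k<y , refl ← ∈-applyUpTo⁻ newDouble v∈ᵈ =
      ∈-successes-policy a≤i a≤i (inj₁ (refl , a<d)) λ where
        (inj₁ (_ , a<d′)) → ℕ.m+n≮m (usedDoubles i) k a<d′
        (inj₂ (a≢a , _))  → a≢a refl
      where
      a<d : usedDoubles i ℕ.+ k ℕ.< usedDoubles (suc i)
      a<d = ℕ.+-monoʳ-< (usedDoubles i) k<y
      -- The new doubles must lie in [t]² for t = suc i; this is what the bound on the total number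
      -- of doubles provides.
      a≤i : usedDoubles i ℕ.+ k ℕ.< suc i
      a≤i = ℕ.<-≤-trans a<d (usedDoubles≤ (suc i) i<n)

    c≤successes : c (suc i) ℕ.≤ length (filter (succeeds? I policy) (allVecs (suc i) 2))
    c≤successes = begin
      c (suc i)                              ≡⟨ length-newSuccesses ⟨
      length newSuccesses                    ≤⟨ Unique-⊆⇒length≤ Unique-newSuccesses (newSuccesses⊆ (Fin.toℕ<n i⋆)) ⟩
      length (successes 2 policy I)          ≡⟨ List.length-map (Vec.map toℕ) wins ⟩
      length wins                            ∎
      where
      open ℕ.≤-Reasoning
      wins : List (Signals I 2)
      wins = filter (succeeds? I policy) (allVecs (suc i) 2)

-- Combining the two bounds.

module _ (n : ℕ) (n≥1 : n ≥ 1) where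

  open Optimum n n≥1
  open LowerBound n (c k⋆) (λ ℓ≤n → k⋆-fits (s≤s ℓ≤n)) using (policy; c≤successes)

  SuccessOf : Policy n → ℝ → Set₁
  SuccessOf π x = ∃ λ (I : Instance n) → x ≡ fromℚ (successProbability 2 π I)

  -- The win counts on the increasing instances satisfy the sum constraints by disjointness, so they
  -- take the place of the ceilings in `<-optimum`. Stated for every lower bound b, it serves both
  -- the infimum for `policy` and the supremum over all policies.
  worstCase≤opt : ∀ π b → (∀ x → SuccessOf π x → b ≤ℝ x) → b ≤ℝ fromℚ opt
  worstCase≤opt π b b≤ q Lq = <-optimum q winCount q<winCount (λ ℓ _ _ → Σ₁-winCount≤ ℓ)
    where
    open UpperBound 2 π
    Below : ℕ → Set
    Below i = q ℚ.< (winCount (suc i) / suc i ^ 2) {{ℕ.m^n≢0 (suc i) 2}}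
    below : ∀ j → Below (toℕ j)
    below j = subst (λ N → q ℚ.< (N / suc (toℕ j) ^ 2) {{ℕ.m^n≢0 (suc (toℕ j)) 2}})
      (sym (winCount-increasing j))
      (b≤ (fromℚ (successProbability 2 π (increasing j))) (increasing j , refl) q Lq)
    q<winCount : ∀ t (t≢0 : NonZero t) → t ℕ.≤ n →
      q ℚ.< (winCount t / t ^ 2) {{ℕ.m^n≢0 t 2 {{t≢0}}}}
    q<winCount (suc i) _ i<n = subst Below (Fin.toℕ-fromℕ< i<n) (below (fromℕ< i<n))

  opt≤successProbability : ∀ I → opt ℚ.≤ successProbability 2 policy I
  opt≤successProbability I = ℚ.≤-trans (opt≤c/t² t)
    (/-mono-≤ (+ c k⋆ t) (t ^ 2) (+ length wins) (t ^ 2) {{ℕ.m^n≢0 t 2}} {{ℕ.m^n≢0 t 2}}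
      (ℤ.*-monoʳ-≤-nonNeg (+ (t ^ 2)) (ℤ.+≤+ (c≤successes I))))
    where
    t : ℕ
    t = Instance.horizon I
    wins : List (Signals I 2)
    wins = filter (succeeds? I policy) (allVecs t 2)

  policy-worstCase : IsWorstCase 2 policy (fromℚ opt)
  policy-worstCase =
    (λ { _ (I , refl) → fromℚ-mono (opt≤successProbability I) }) , worstCase≤opt policy

  opt-isOPT : IsOPT n 2 (fromℚ opt)
  opt-isOPT =
    (λ x (π , x≤ , _) → worstCase≤opt π x x≤) ,
    -- The supremum is attained by `policy`, so every upper bound is at least `opt`.
    λ b ≤b → ≤b (fromℚ opt) (policy , policy-worstCase)

theorem14 : (n : ℕ) → n ≥ 1 →
    ∃ λ (OPT : ℝ) → IsOPT n 2 OPT × IsMax (Feasible n) OPT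
theorem14 n n≥1 = fromℚ opt , opt-isOPT n n≥1 , opt-isMax
  where open Optimum n n≥1
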